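{- There is an explicit deterministic protocol in the 3-player Number-On-the-Forehead model that computes the exactly-$N$ function $f:[N]^3\to\{0,1\}$ (where $f(x,y,z)=1$ iff $x+y+z=N$) correctly on all inputs, with communication complexity $2\sqrt{\log e}\sqrt{\log N}+o(\sqrt{\log N})$.
   Context: In the 3-player Number-On-the-Forehead (NOF) model, inputs $x,y,z\in[N]=\{1,\dots,N\}$ are placed on the foreheads of players $P_x,P_y,P_z$ respectively, so $P_x$ sees $(y,z)$, $P_y$ sees $(x,z)$, and $P_z$ sees $(x,y)$. Following a protocol fixed in advance, the players take turns writing bits on a blackboard visible to all; at the end every player must be able to determine $f(x,y,z)$ from the inputs she sees and the blackboard contents. The complexity of a protocol is the maximum number of bits written over all inputs. Logarithms are base $2$; asymptotics are as $N\to\infty$. -}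

module Defs where

open import Data.Nat using (ℕ; zero; suc; _+_; _*_; _^_; _≡ᵇ_)
open import Data.Nat.Properties using (m^n≢0; m*n≢0)
open import Data.Fin using (Fin; toℕ)
open import Data.Bool using (Bool)
open import Data.Integer using (+_)
import Data.Rational as ℚ
open import Data.Rational using (ℚ; 0ℚ; _/_)

-- Inputs x,y,z ∈ [N] = {1,…,N} are represented by Fin N, with
-- i : Fin N standing for the number toℕ i + 1.
In : ℕ → Set
In N = Fin N

exactlyN : (N : ℕ) → In N → In N → In N → Bool
exactlyN N x y z = (suc (toℕ x) + suc (toℕ y) + suc (toℕ z)) ≡ᵇ N

-- A deterministic 3-player NOF protocol (protocol tree).
-- P_x sees (y,z), P_y sees (x,z), P_z sees (x,y).
-- At an internal node the player whose turn it is (fixed by the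
-- transcript so far) writes one bit, computed from what she sees.
-- At a leaf (= a full transcript) each player outputs a bit computed
-- from what she sees.
data Protocol (N : ℕ) : Set where
  leaf   : (outX : In N → In N → Bool)   -- P_x's output from (y,z)
           (outY : In N → In N → Bool)   -- P_y's output from (x,z)
           (outZ : In N → In N → Bool)   -- P_z's output from (x,y)
           → Protocol N
  speakX : (In N → In N → Bool) → (Bool → Protocol N) → Protocol N  -- bit from (y,z)
  speakY : (In N → In N → Bool) → (Bool → Protocol N) → Protocol N  -- bit from (x,z)
  speakZ : (In N → In N → Bool) → (Bool → Protocol N) → Protocol N  -- bit from (x,y)

bits : {N : ℕ} → Protocol N → In N → In N → In N → ℕ
bits (leaf _ _ _)   x y z = 0
bits (speakX m k) x y z = suc (bits (k (m y z)) x y z)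
bits (speakY m k) x y z = suc (bits (k (m x z)) x y z)
bits (speakZ m k) x y z = suc (bits (k (m x y)) x y z)

outputX outputY outputZ : {N : ℕ} → Protocol N → In N → In N → In N → Bool
outputX (leaf oX _ _) x y z = oX y z
outputX (speakX m k) x y z = outputX (k (m y z)) x y z
outputX (speakY m k) x y z = outputX (k (m x z)) x y z
outputX (speakZ m k) x y z = outputX (k (m x y)) x y z
outputY (leaf _ oY _) x y z = oY x z
outputY (speakX m k) x y z = outputY (k (m y z)) x y z
outputY (speakY m k) x y z = outputY (k (m x z)) x y z
outputY (speakZ m k) x y z = outputY (k (m x y)) x y z
outputZ (leaf _ _ oZ) x y z = oZ x y
outputZ (speakX m k) x y z = outputZ (k (m y z)) x y z
outputZ (speakY m k) x y z = outputZ (k (m x z)) x y z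
outputZ (speakZ m k) x y z = outputZ (k (m x y)) x y z

-- Partial sums of ln 2 = Σ_{k ≥ 1} 1 / (k · 2^k):
-- lnTwoPartial K = Σ_{k=1}^{K} 1/(k · 2^k).  These increase strictly to ln 2.
lnTwoPartial : ℕ → ℚ
lnTwoPartial zero    = 0ℚ
lnTwoPartial (suc k) =
  lnTwoPartial k ℚ.+
    ((+ 1) / (suc k * 2 ^ suc k)) {{m*n≢0 (suc k) (2 ^ suc k) {{_}} {{m^n≢0 2 (suc k)}}}}

{-# OPTIONS --safe #-}
-- Let x′ = N - y - z and y′ = N - x - z, which P_x and P_y can compute; then x′ + y = x + y′,
-- and x + y + z = N iff x′ = x.  Write numbers in base q = 2h with d digits.  For any (x, y),
-- exactly three of the four ways of adding 0 or h to either number put a digit sum in [h, 3h),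
-- whatever the carries from below; so a random shift with digits in {0, h} makes all d digit
-- sums of the given pair (x, y), as seen by P_z, lie in [h, 3h) with probability
-- (3/4)ᵈ, and a greedy choice of about (4/3)ᵈ log N² shifts serves all inputs.  P_z announces
-- such a shift and the squared distance r of the digit vectors; P_x and P_y each confirm that
-- (x′, y) and (x, y′) have digit sums in [h, 3h) and distance r.  The window having length q,
-- x′ + y = x + y′ then holds digit by digit, and the parallelogram law forces x′ = x.
--
-- The cost is d log(4/3) + 2 log q + O(log log N).  With k = log h and d = 4k it is bounded by
-- 4k + o(k) for log N ≈ 4k², that is by (2 + o(1)) √(log N), already below 2 √(log e) √(log N);
-- the comparison with log e then only needs ln 2 ≤ 3/4.
module Submission where

open import Defs
open import Data.Bool using (Bool; true; false; T; if_then_else_; _∧_)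
open import Data.Bool.Properties using (T?; T-∧; T-≡; ¬-not; ⇔→≡)
open import Data.Empty using (⊥-elim)
open import Data.Fin using (toℕ)
open import Data.Fin.Properties using (toℕ<n)
import Data.Integer as ℤ
open import Data.Integer using (+_; +≤+)
import Data.Integer.Properties as ℤ
import Data.Integer.Tactic.RingSolver as ℤ-Solver
open import Data.List using (List; []; _∷_; _++_; length; map; filter; allFin; cartesianProduct)
open import Data.List.Membership.Propositional using (_∈_)
open import Data.List.Membership.Propositional.Properties using (∈-filter⁺; ∈-allFin; ∈-cartesianProduct⁺)
open import Data.List.Properties using (length-++; length-map; length-tabulate)
open import Data.List.Relation.Unary.Any using (Any; here; there)
open import Data.List.Relation.Unary.Any.Properties using (++⁺ˡ; ++⁺ʳ)
open import Data.Nat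
open import Data.Nat.DivMod
open import Data.Nat.Divisibility using (_∣_; ∣⇒≤; *-monoʳ-∣; 1∣_; divides-refl)
open import Data.Nat.ListAction using (sum)
open import Data.Nat.Properties
open import Data.Nat.Tactic.RingSolver using (solve-∀)
open import Data.Product using (Σ; ∃; _×_; _,_; proj₁; proj₂)
import Data.Rational as ℚ
open import Data.Rational using (toℚᵘ) renaming (_*_ to _*ℚ_)
import Data.Rational.Properties as ℚ
import Data.Rational.Unnormalised as ℚᵘ
open import Data.Rational.Unnormalised using (mkℚᵘ; *≤*)
import Data.Rational.Unnormalised.Properties as ℚᵘ
open import Data.Sum using (_⊎_; inj₁; inj₂)
open import Function using (_∘_; id; Equivalence; mk⇔)
open import Relation.Binary.PropositionalEquality
open import Relation.Nullary using (yes; no; ¬_; ¬?)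

-- Greedy covers

indicator : Bool → ℕ
indicator b = if b then 1 else 0

count : ∀ {A : Set} → (A → Bool) → List A → ℕ
count p xs = sum (map (λ x → indicator (p x)) xs)

count-++ : ∀ {A : Set} (p : A → Bool) xs ys → count p (xs ++ ys) ≡ count p xs + count p ys
count-++ p []       ys = refl
count-++ p (x ∷ xs) ys =
  trans (cong (_+_ (indicator (p x))) (count-++ p xs ys)) (sym (+-assoc (indicator (p x)) _ _))

sum-map-+ : ∀ {A : Set} (f g : A → ℕ) xs →
            sum (map (λ x → f x + g x) xs) ≡ sum (map f xs) + sum (map g xs)
sum-map-+ f g []       = refl
sum-map-+ f g (x ∷ xs) = trans (cong (_+_ (f x + g x)) (sum-map-+ f g xs)) (lemma (f x) (g x) _ _)
  where
  lemma : ∀ a b c d → a + b + (c + d) ≡ a + c + (b + d)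
  lemma = solve-∀

-- Each failure `D * f a < B` leaves one unit of slack, and the summand `length as` collects these
-- units, so that averaging over a nonempty list becomes strict.
pigeonhole : ∀ {A : Set} (f : A → ℕ) D B as →
             (∃ λ a → B ≤ D * f a) ⊎ (D * sum (map f as) + length as ≤ length as * B)
pigeonhole f D B []       = inj₂ (≤-reflexive (trans (+-identityʳ _) (*-zeroʳ D)))
pigeonhole f D B (a ∷ as) with B ≤? D * f a | pigeonhole f D B as
... | yes B≤ | _         = inj₁ (a , B≤)
... | no  _  | inj₁ found = inj₁ found
... | no  B≰ | inj₂ small = inj₂ (begin
  D * (f a + sum (map f as)) + suc (length as)     ≡⟨ lemma D (f a) _ _ ⟩
  suc (D * f a) + (D * sum (map f as) + length as) ≤⟨ +-mono-≤ (≰⇒> B≰) small ⟩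
  B + length as * B                                ∎)
  where
  open ≤-Reasoning
  lemma : ∀ D x s l → D * (x + s) + suc l ≡ suc (D * x) + (D * s + l)
  lemma = solve-∀

module GreedyCover
  {A U : Set} (covers : A → U → Bool) (as : List A) (0<as : 0 < length as)
  (D : ℕ) (0<D : 0 < D)
  (dense : ∀ u → length as ≤ D * count (λ a → covers a u) as)
  where

  private instance
    D≢0 : NonZero D
    D≢0 = >-nonZero 0<D

  -- Covering pairs are counted in two orders: by `dense` every `u` is covered by at least a 1/D
  -- fraction of `as`, and the total is regrouped by the elements of `as`.
  double-count : ∀ us → length as * length us ≤ D * sum (map (λ a → count (covers a) us) as)
  double-count []       = ≤-trans (≤-reflexive (*-zeroʳ (length as))) z≤n
  double-count (u ∷ us) = begin
    length as * suc (length us)                       ≡⟨ *-suc (length as) (length us) ⟩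
    length as + length as * length us                 ≤⟨ +-mono-≤ (dense u) (double-count us) ⟩
    D * count (λ a → covers a u) as + D * sum (map (λ a → count (covers a) us) as)
                                                      ≡⟨ *-distribˡ-+ D (count (λ a → covers a u) as) _ ⟨
    D * (count (λ a → covers a u) as + sum (map (λ a → count (covers a) us) as))
                                                      ≡⟨ cong (D *_) (sum-map-+ (λ a → indicator (covers a u)) (λ a → count (covers a) us) as) ⟨
    D * sum (map (λ a → count (covers a) (u ∷ us)) as) ∎
    where open ≤-Reasoning

  heavy : ∀ us → ∃ λ a → length us ≤ D * count (covers a) us
  heavy us with pigeonhole (λ a → count (covers a) us) D (length us) as
  ... | inj₁ found = found
  ... | inj₂ small = ⊥-elim (<-irrefl refl (begin-strict
      D * S             <⟨ m<m+n (D * S) 0<as ⟩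
      D * S + length as ≤⟨ small ⟩
      length as * length us ≤⟨ double-count us ⟩
      D * S             ∎))
    where
    open ≤-Reasoning
    S = sum (map (λ a → count (covers a) us) as)

  uncovered : A → List U → List U
  uncovered a = filter (λ u → ¬? (T? (covers a u)))

  count+uncovered : ∀ a us → count (covers a) us + length (uncovered a us) ≡ length us
  count+uncovered a []       = refl
  count+uncovered a (u ∷ us) with covers a u
  ... | true  = cong suc (count+uncovered a us)
  ... | false = trans (+-suc _ _) (cong suc (count+uncovered a us))

  -- With c covered and r left, r ≤ c + r ≤ D c gives (D + 1) r ≤ D (c + r). The factor D/(D + 1) is
  -- slightly weaker than 1 - 1/D but needs no subtraction.
  step : ∀ us → ∃ λ a → suc D * length (uncovered a us) ≤ D * length us
  step us with heavy us
  ... | a , us≤ = a , (begin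
    r + D * r   ≤⟨ +-monoˡ-≤ (D * r) (≤-trans (m≤n+m r c) (≤-trans (≤-reflexive split) us≤)) ⟩
    D * c + D * r ≡⟨ *-distribˡ-+ D c r ⟨
    D * (c + r)   ≡⟨ cong (D *_) split ⟩
    D * length us ∎)
    where
    open ≤-Reasoning
    c = count (covers a) us
    r = length (uncovered a us)
    split = count+uncovered a us

  Covered : List A → U → Set
  Covered cs u = Any (λ a → T (covers a u)) cs

  -- (1 - 1/D)ⁿ ≤ D/(D + n).
  greedy : ∀ n us → ∃ λ cs → ∃ λ rest → length cs ≡ n
           × (∀ {u} → u ∈ us → Covered cs u ⊎ u ∈ rest)
           × (D + n) * length rest ≤ D * length us
  greedy zero    us = [] , us , refl , inj₂ , ≤-reflexive (cong (_* length us) (+-identityʳ D))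
  greedy (suc n) us with step us
  ... | a , shrink with greedy n (uncovered a us)
  ...   | cs , rest , len , cov , bound = a ∷ cs , rest , cong suc len , cov′ , bound′
    where
    cov′ : ∀ {u} → u ∈ us → Covered (a ∷ cs) u ⊎ u ∈ rest
    cov′ {u} u∈us with T? (covers a u)
    ... | yes t = inj₁ (here t)
    ... | no ¬t with cov (∈-filter⁺ (λ u → ¬? (T? (covers a u))) u∈us ¬t)
    ...   | inj₁ c = inj₁ (there c)
    ...   | inj₂ r = inj₂ r
    open ≤-Reasoning
    r  = length rest
    u₁ = length (uncovered a us)
    split : ∀ D n r → suc D * ((D + n) * r) ≡ D * ((D + suc n) * r) + n * r
    split = solve-∀
    swap : ∀ D u → suc D * (D * u) ≡ D * (suc D * u)
    swap = solve-∀
    -- (D + 1)(D + n) = D (D + n + 1) + n, and the surplus `n * r` is dropped.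
    bound′ : (D + suc n) * r ≤ D * length us
    bound′ = *-cancelˡ-≤ D (begin
      D * ((D + suc n) * r)         ≤⟨ m≤m+n _ (n * r) ⟩
      D * ((D + suc n) * r) + n * r ≡⟨ split D n r ⟨
      suc D * ((D + n) * r)         ≤⟨ *-monoʳ-≤ (suc D) bound ⟩
      suc D * (D * u₁)              ≡⟨ swap D u₁ ⟩
      D * (suc D * u₁)              ≤⟨ *-monoʳ-≤ D shrink ⟩
      D * (D * length us)           ∎)

  -- At n = D the bound of `greedy` has the factor 2D on the left, so `D` picks halve what is
  -- uncovered, and m halvings exhaust fewer than 2^m elements.
  cover : ∀ m us → length us < 2 ^ m →
          ∃ λ cs → length cs ≡ m * D × (∀ {u} → u ∈ us → Covered cs u)
  cover zero    []      _         = [] , refl , λ ()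
  cover zero    (_ ∷ _) (s≤s ())
  cover (suc m) us      us<
    with greedy D us
  ... | cs , rest , len , cov , bound
    with cover m rest (*-cancelˡ-< 2 _ _ (≤-<-trans halved us<))
    where
    double : ∀ D r → (D + D) * r ≡ D * (2 * r)
    double = solve-∀
    halved : 2 * length rest ≤ length us
    halved = *-cancelˡ-≤ D (≤-trans (≤-reflexive (sym (double D (length rest)))) bound)
  ...   | cs′ , len′ , cov′ =
          cs ++ cs′ , trans (length-++ cs) (cong₂ _+_ len len′) , both
    where
    both : ∀ {u} → u ∈ us → Covered (cs ++ cs′) u
    both u∈us with cov u∈us
    ... | inj₁ c = ++⁺ˡ c
    ... | inj₂ r = ++⁺ʳ cs (cov′ r)

-- The default `a₀` makes decoding total: every number read off the blackboard names some shift.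
nth : ∀ {A : Set} → A → List A → ℕ → A
nth a₀ []       _       = a₀
nth a₀ (x ∷ xs) zero    = x
nth a₀ (x ∷ xs) (suc i) = nth a₀ xs i

Any⇒nth : ∀ {A : Set} {P : A → Set} a₀ {xs} → Any P xs →
          ∃ λ i → i < length xs × P (nth a₀ xs i)
Any⇒nth a₀ (here p)  = zero , z<s , p
Any⇒nth a₀ (there w) with Any⇒nth a₀ w
... | i , i< , p = suc i , s<s i< , p

-- Digit vectors

sq : ℕ → ℕ
sq n = n * n

∣-∣-square : ∀ m n → + sq ∣ m - n ∣ ≡ (+ m ℤ.- + n) ℤ.* (+ m ℤ.- + n)
∣-∣-square m n with ≤-total m n
... | inj₁ m≤n rewrite ℤ.m-n≡m⊖n m n | ℤ.⊖-≤ m≤n | m≤n⇒∣m-n∣≡n∸m m≤n =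
  trans (ℤ.pos-* (n ∸ m) (n ∸ m)) (lemma (+ (n ∸ m)))
  where
  lemma : ∀ a → a ℤ.* a ≡ (ℤ.- a) ℤ.* (ℤ.- a)
  lemma = ℤ-Solver.solve-∀
... | inj₂ n≤m rewrite ℤ.m-n≡m⊖n m n | ℤ.⊖-≥ n≤m | ∣-∣-comm m n | m≤n⇒∣m-n∣≡n∸m n≤m =
  ℤ.pos-* (m ∸ n) (m ∸ n)

-- With u = x - y and v = x′ - x, the hypothesis gives x′ - y = u + v and x - y′ = u - v, and (u +
-- v)² + (u - v)² = 2 (u² + v²).
parallelogram : ∀ {x x′ y y′} → x′ + y ≡ x + y′ →
  sq ∣ x′ - y ∣ + sq ∣ x - y′ ∣ ≡ 2 * (sq ∣ x - y ∣ + sq ∣ x′ - x ∣)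
parallelogram {x} {x′} {y} {y′} sums = ℤ.+-injective (begin
  + sq ∣ x′ - y ∣ ℤ.+ + sq ∣ x - y′ ∣
    ≡⟨ cong₂ ℤ._+_ (∣-∣-square x′ y) (∣-∣-square x y′) ⟩
  S (+ x′) (+ y) ℤ.+ S (+ x) (+ y′)
    ≡⟨ cong (λ w → S (+ x′) (+ y) ℤ.+ S (+ x) w) y′≡ ⟩
  S (+ x′) (+ y) ℤ.+ S (+ x) (+ x′ ℤ.+ + y ℤ.- + x)
    ≡⟨ expand (+ x) (+ x′) (+ y) ⟩
  + 2 ℤ.* (S (+ x) (+ y) ℤ.+ S (+ x′) (+ x))
    ≡⟨ cong (+ 2 ℤ.*_) (cong₂ ℤ._+_ (∣-∣-square x y) (∣-∣-square x′ x)) ⟨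
  + 2 ℤ.* + (sq ∣ x - y ∣ + sq ∣ x′ - x ∣)
    ≡⟨ ℤ.pos-* 2 (sq ∣ x - y ∣ + sq ∣ x′ - x ∣) ⟨
  + (2 * (sq ∣ x - y ∣ + sq ∣ x′ - x ∣)) ∎)
  where
  open ≡-Reasoning
  S : ℤ.ℤ → ℤ.ℤ → ℤ.ℤ
  S a b = (a ℤ.- b) ℤ.* (a ℤ.- b)
  cancel : ∀ a b → b ≡ a ℤ.+ b ℤ.- a
  cancel = ℤ-Solver.solve-∀
  y′≡ : + y′ ≡ + x′ ℤ.+ + y ℤ.- + x
  y′≡ = trans (cancel (+ x) (+ y′)) (cong (λ s → + s ℤ.- + x) (sym sums))
  expand : ∀ x x′ y → (x′ ℤ.- y) ℤ.* (x′ ℤ.- y)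
             ℤ.+ (x ℤ.- (x′ ℤ.+ y ℤ.- x)) ℤ.* (x ℤ.- (x′ ℤ.+ y ℤ.- x))
           ≡ + 2 ℤ.* ((x ℤ.- y) ℤ.* (x ℤ.- y) ℤ.+ (x′ ℤ.- x) ℤ.* (x′ ℤ.- x))
  expand = ℤ-Solver.solve-∀

module Digits (h : ℕ) .{{_ : NonZero h}} where

  q : ℕ
  q = 2 * h

  instance
    q≢0 : NonZero q
    q≢0 = m*n≢0 2 h

  central : ℕ → ℕ → Bool
  central x y = (h ≤ᵇ x + y) ∧ (x + y <ᵇ 3 * h)

  -- Only the lowest `d` digits count, here and in `dist²`, so a shifted number may exceed q^d.
  balanced : ℕ → ℕ → ℕ → Bool
  balanced zero    X Y = true
  balanced (suc d) X Y = central (X % q) (Y % q) ∧ balanced d (X / q) (Y / q)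

  dist² : ℕ → ℕ → ℕ → ℕ
  dist² zero    X Y = 0
  dist² (suc d) X Y = sq ∣ X % q - Y % q ∣ + dist² d (X / q) (Y / q)

  dist²-bound : ∀ d X Y → dist² d X Y ≤ d * sq q
  dist²-bound zero    X Y = z≤n
  dist²-bound (suc d) X Y = +-mono-≤ (*-mono-≤ b b) (dist²-bound d (X / q) (Y / q))
    where
    b : ∣ X % q - Y % q ∣ ≤ q
    b = ≤-trans (∣m-n∣≤m⊔n (X % q) (Y % q)) (⊔-lub (m%n≤n X q) (m%n≤n Y q))

  central⇒ : ∀ {x y} → T (central x y) → h ≤ x + y × x + y < 3 * h
  central⇒ {x} {y} c with Equivalence.to (T-∧ {h ≤ᵇ x + y}) c
  ... | l , u = ≤ᵇ⇒≤ h (x + y) l , <ᵇ⇒< (x + y) (3 * h) u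

  -- The window [h, 3h) has length q, so s + e q determines s and e.
  window-≤ : ∀ {s t e f} → h ≤ t → s < 3 * h → s + e * q ≡ t + f * q → f ≤ e
  window-≤ {s} {t} {e} {f} h≤t s<3h eq with f ≤? e
  ... | yes f≤e = f≤e
  ... | no  f≰e = ⊥-elim (<-irrefl eq (begin-strict
    s + e * q       <⟨ +-monoˡ-< (e * q) s<3h ⟩
    3 * h + e * q   ≡⟨ regroup h e ⟩
    h + suc e * q   ≤⟨ +-mono-≤ h≤t (*-monoˡ-≤ q (≰⇒> f≰e)) ⟩
    t + f * q       ∎))
    where
    open ≤-Reasoning
    regroup : ∀ h e → 3 * h + e * (2 * h) ≡ h + suc e * (2 * h)
    regroup = solve-∀

  -- Both low sums lie in the window, so `window-≤` in the two directions equates the quotient sums,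
  -- and cancelling them equates the low sums. The equality of quotient sums is again the hypothesis
  -- for the next digit.
  digitwise : ∀ {X X′ Y Y′} → X′ + Y ≡ X + Y′ →
              T (central (X′ % q) (Y % q)) → T (central (X % q) (Y′ % q)) →
              X′ % q + Y % q ≡ X % q + Y′ % q × X′ / q + Y / q ≡ X / q + Y′ / q
  digitwise {X} {X′} {Y} {Y′} sums c c′ = +-cancelʳ-≡ (e * q) _ _ eq′ , e≡f
    where
    open ≡-Reasoning
    e = X′ / q + Y / q
    f = X / q + Y′ / q
    regroup : ∀ a b c d q → a + b * q + (c + d * q) ≡ a + c + (b + d) * q
    regroup = solve-∀
    expand : ∀ A B → A + B ≡ A % q + B % q + (A / q + B / q) * q
    expand A B = trans (cong₂ _+_ (m≡m%n+[m/n]*n A q) (m≡m%n+[m/n]*n B q))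
                       (regroup (A % q) (A / q) (B % q) (B / q) q)
    eq : X′ % q + Y % q + e * q ≡ X % q + Y′ % q + f * q
    eq = trans (sym (expand X′ Y)) (trans sums (expand X Y′))
    w  = central⇒ {X′ % q} {Y % q} c
    w′ = central⇒ {X % q} {Y′ % q} c′
    e≡f : e ≡ f
    e≡f = ≤-antisym (window-≤ (proj₁ w) (proj₂ w′) (sym eq)) (window-≤ (proj₁ w′) (proj₂ w) eq)
    eq′ : X′ % q + Y % q + e * q ≡ X % q + Y′ % q + e * q
    eq′ = trans eq (cong (λ g → X % q + Y′ % q + g * q) (sym e≡f))

  dist²-parallelogram : ∀ d {X X′ Y Y′} → X′ + Y ≡ X + Y′ →
    T (balanced d X′ Y) → T (balanced d X Y′) →
    dist² d X′ Y + dist² d X Y′ ≡ 2 * (dist² d X Y + dist² d X′ X)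
  dist²-parallelogram zero    _ _ _ = refl
  dist²-parallelogram (suc d) {X} {X′} {Y} {Y′} sums b b′
    with Equivalence.to (T-∧ {central (X′ % q) (Y % q)}) b
       | Equivalence.to (T-∧ {central (X % q) (Y′ % q)}) b′
  ... | c , bs | c′ , bs′ with digitwise {X} {X′} {Y} {Y′} sums c c′
  ...   | low , high = begin
    a₁ + A₁ + (a₂ + A₂)                  ≡⟨ interchange a₁ A₁ a₂ A₂ ⟩
    a₁ + a₂ + (A₁ + A₂)                  ≡⟨ cong₂ _+_ (parallelogram {X % q} low) (dist²-parallelogram d high bs bs′) ⟩
    2 * (a₃ + a₄) + 2 * (A₃ + A₄)        ≡⟨ regroup a₃ a₄ A₃ A₄ ⟩
    2 * (a₃ + A₃ + (a₄ + A₄))            ∎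
    where
    open ≡-Reasoning
    a₁ = sq ∣ X′ % q - Y % q ∣
    a₂ = sq ∣ X % q - Y′ % q ∣
    a₃ = sq ∣ X % q - Y % q ∣
    a₄ = sq ∣ X′ % q - X % q ∣
    A₁ = dist² d (X′ / q) (Y / q)
    A₂ = dist² d (X / q) (Y′ / q)
    A₃ = dist² d (X / q) (Y / q)
    A₄ = dist² d (X′ / q) (X / q)
    interchange : ∀ a b c d → a + b + (c + d) ≡ a + c + (b + d)
    interchange = solve-∀
    regroup : ∀ a b c d → 2 * (a + b) + 2 * (c + d) ≡ 2 * (a + c + (b + d))
    regroup = solve-∀

  -- A vanishing sum of squares makes the lowest `d` digits agree. Higher digits are unseen, so this
  -- is only a congruence modulo q^d.
  dist²≡0⇒∣ : ∀ d X Y → dist² d X Y ≡ 0 → q ^ d ∣ ∣ X - Y ∣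
  dist²≡0⇒∣ zero    X Y _  = 1∣ _
  dist²≡0⇒∣ (suc d) X Y eq = subst (q * q ^ d ∣_) (sym diff)
      (*-monoʳ-∣ q (dist²≡0⇒∣ d (X / q) (Y / q) (m+n≡0⇒n≡0 (sq ∣ X % q - Y % q ∣) eq)))
    where
    open ≡-Reasoning
    δ = ∣ X % q - Y % q ∣
    δ≡0 : δ ≡ 0
    δ≡0 with m*n≡0⇒m≡0∨n≡0 δ (m+n≡0⇒m≡0 (sq δ) eq)
    ... | inj₁ p = p
    ... | inj₂ p = p
    low : Y % q ≡ X % q
    low = sym (∣m-n∣≡0⇒m≡n δ≡0)
    diff : ∣ X - Y ∣ ≡ q * ∣ X / q - Y / q ∣
    diff = begin
      ∣ X - Y ∣
        ≡⟨ cong₂ ∣_-_∣ (m≡m%n+[m/n]*n X q) (trans (m≡m%n+[m/n]*n Y q) (cong (_+ Y / q * q) low)) ⟩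
      ∣ X % q + X / q * q - X % q + Y / q * q ∣
        ≡⟨ ∣m+n-m+o∣≡∣n-o∣ (X % q) (X / q * q) (Y / q * q) ⟩
      ∣ X / q * q - Y / q * q ∣
        ≡⟨ *-distribʳ-∣-∣ q (X / q) (Y / q) ⟨
      ∣ X / q - Y / q ∣ * q
        ≡⟨ *-comm ∣ X / q - Y / q ∣ q ⟩
      q * ∣ X / q - Y / q ∣ ∎

  -- Shifting preserves x′ + y = x + y′. With all three squared distances equal to R, the
  -- parallelogram law reads 2R = 2 (R + E), where E is the squared distance of x′ + a and x + a. So
  -- E = 0, and q^d divides |x′ - x|, which is below q^d.
  corner-free : ∀ d {a b x x′ y y′} → x < q ^ d → x′ < q ^ d → x′ + y ≡ x + y′ →
    T (balanced d (x′ + a) (y + b)) → T (balanced d (x + a) (y′ + b)) →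
    dist² d (x′ + a) (y + b) ≡ dist² d (x + a) (y + b) →
    dist² d (x + a) (y′ + b) ≡ dist² d (x + a) (y + b) →
    x′ ≡ x
  corner-free d {a} {b} {x} {x′} {y} {y′} x< x′< sums bal bal′ r r′ =
    ∣m-n∣≡0⇒m≡n (small ∣ x′ - x ∣ (≤-<-trans (∣m-n∣≤m⊔n x′ x) (⊔-pres-<m x′< x<)) divides)
    where
    regroup : ∀ a b x y → x + a + (y + b) ≡ x + y + (a + b)
    regroup = solve-∀
    sums′ : x′ + a + (y + b) ≡ x + a + (y′ + b)
    sums′ = trans (regroup a b x′ y) (trans (cong (_+ (a + b)) sums) (sym (regroup a b x y′)))
    R = dist² d (x + a) (y + b)
    E = dist² d (x′ + a) (x + a)
    double : ∀ R E → 2 * (R + E) ≡ R + R + (E + E)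
    double = solve-∀
    E≡0 : E ≡ 0
    E≡0 = m+n≡0⇒m≡0 E (sym (+-cancelˡ-≡ (R + R) 0 (E + E) (trans (+-identityʳ (R + R))
            (trans (sym (cong₂ _+_ r r′)) (trans (dist²-parallelogram d sums′ bal bal′) (double R E))))))
    shift : ∣ x′ + a - x + a ∣ ≡ ∣ x′ - x ∣
    shift = trans (cong₂ ∣_-_∣ (+-comm x′ a) (+-comm x a)) (∣m+n-m+o∣≡∣n-o∣ a x′ x)
    divides : q ^ d ∣ ∣ x′ - x ∣
    divides = subst (q ^ d ∣_) shift (dist²≡0⇒∣ d (x′ + a) (x + a) E≡0)
    small : ∀ δ → δ < q ^ d → q ^ d ∣ δ → δ ≡ 0
    small zero    _  _  = refl
    small (suc δ) δ< dv = ⊥-elim (<-irrefl refl (<-≤-trans δ< (∣⇒≤ dv)))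

  -- Random shifts with digits 0 and h

  half-turn : ∀ X → ∃ λ r → r < h × ((X % q ≡ r × (X + h) % q ≡ h + r)
                                   ⊎ (X % q ≡ h + r × (X + h) % q ≡ r))
  half-turn X with X % q <? h
  ... | yes r<h = X % q , r<h , inj₁ (refl , (begin
    (X + h) % q               ≡⟨ cong (_% q) (trans (cong (_+ h) (m≡m%n+[m/n]*n X q)) (regroup (X % q) _ h)) ⟩
    (h + X % q + X / q * q) % q ≡⟨ [m+kn]%n≡m%n (h + X % q) (X / q) q ⟩
    (h + X % q) % q           ≡⟨ m<n⇒m%n≡m (subst (h + X % q <_) (cong (_+_ h) (sym (+-identityʳ h))) (+-monoʳ-< h r<h)) ⟩
    h + X % q                 ∎))
    where
    open ≡-Reasoning
    regroup : ∀ r c h → r + c + h ≡ h + r + c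
    regroup = solve-∀
  ... | no  r≮h = X % q ∸ h , s<h , inj₂ (sym h+s≡ , (begin
    (X + h) % q                 ≡⟨ cong (_% q) (trans (cong (_+ h)
                                     (trans (m≡m%n+[m/n]*n X q) (cong (_+ X / q * q) (sym h+s≡))))
                                     (regroup (X % q ∸ h) (X / q) h)) ⟩
    (X % q ∸ h + suc (X / q) * q) % q ≡⟨ [m+kn]%n≡m%n (X % q ∸ h) (suc (X / q)) q ⟩
    (X % q ∸ h) % q             ≡⟨ m<n⇒m%n≡m (<-≤-trans s<h (m≤m+n h _)) ⟩
    X % q ∸ h                   ∎))
    where
    open ≡-Reasoning
    h+s≡ : h + (X % q ∸ h) ≡ X % q
    h+s≡ = m+[n∸m]≡n (≮⇒≥ r≮h)
    s<h : X % q ∸ h < h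
    s<h = +-cancelˡ-< h _ _ (subst (_< h + h) (sym h+s≡) (subst (X % q <_) (cong (_+_ h) (+-identityʳ h)) (m%n<n X q)))
    regroup : ∀ s e h → h + s + e * (2 * h) + h ≡ s + suc e * (2 * h)
    regroup = solve-∀

  weight : ℕ → ℕ → ℕ
  weight x y = indicator (central x y)

  weight-central : ∀ x y → h ≤ x + y → x + y < 3 * h → weight x y ≡ 1
  weight-central x y l u = cong indicator (Equivalence.to T-≡
    (Equivalence.from (T-∧ {h ≤ᵇ x + y}) (≤⇒≤ᵇ l , <⇒<ᵇ u)))

  weight-off : ∀ x y → ¬ (h ≤ x + y × x + y < 3 * h) → weight x y ≡ 0
  weight-off x y off = cong indicator (¬-not λ eq →
    off (central⇒ {x} {y} (Equivalence.from T-≡ eq)))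

  -- The sums are r + s, twice h + r + s, and 2h + r + s, where r + s < 2h. The middle ones always
  -- lie in [h, 3h); of the outer two, only the first does if r + s ≥ h, and only the last
  -- otherwise.
  three-of-four : ∀ r s → r < h → s < h →
    weight r s + weight (h + r) s + weight r (h + s) + weight (h + r) (h + s) ≡ 3
  three-of-four r s r<h s<h = trans (cong₂ (λ m n → weight r s + m + n + weight (h + r) (h + s)) mid₁ mid₂) outer
    where
    regroup : ∀ a b c → a + b + c ≡ b + (a + c)
    regroup = solve-∀
    r+s< : r + s < 2 * h
    r+s< = subst (r + s <_) (cong (_+_ h) (sym (+-identityʳ h))) (+-mono-< r<h s<h)
    mid₁ : weight (h + r) s ≡ 1
    mid₁ = weight-central (h + r) s (≤-trans (m≤m+n h r) (m≤m+n (h + r) s))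
             (subst (_< 3 * h) (sym (+-assoc h r s)) (+-monoʳ-< h r+s<))
    mid₂ : weight r (h + s) ≡ 1
    mid₂ = weight-central r (h + s) (≤-trans (m≤m+n h s) (m≤n+m (h + s) r))
             (subst (_< 3 * h) (regroup′ h r s) (+-monoʳ-< h r+s<))
      where
      regroup′ : ∀ h r s → h + (r + s) ≡ r + (h + s)
      regroup′ = solve-∀
    corner : ∀ h r s → h + r + (h + s) ≡ 2 * h + (r + s)
    corner = solve-∀
    three : ∀ h → 2 * h + h ≡ 3 * h
    three = solve-∀
    outer : weight r s + 1 + 1 + weight (h + r) (h + s) ≡ 3
    outer with h ≤? r + s
    ... | yes h≤ = cong₂ (λ m n → m + 1 + 1 + n)
          (weight-central r s h≤ (<-≤-trans r+s< (m≤n+m (2 * h) h)))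
          (weight-off (h + r) (h + s) λ { (_ , u) → <-irrefl refl (<-≤-trans u
            (subst₂ _≤_ (three h) (sym (corner h r s)) (+-monoʳ-≤ (2 * h) h≤))) })
    ... | no  h≰ = cong₂ (λ m n → m + 1 + 1 + n)
          (weight-off r s λ { (l , _) → h≰ l })
          (weight-central (h + r) (h + s) (≤-trans (m≤m+n h r) (m≤m+n (h + r) (h + s)))
            (subst₂ _<_ (sym (corner h r s)) (three h) (+-monoʳ-< (2 * h) (≰⇒> h≰))))

  -- Adding `h` modulo `q` exchanges the residues r and h + r, so each case only permutes the terms
  -- of `three-of-four`.
  weights-of-shifts : ∀ X Y →
    weight (X % q) (Y % q) + weight ((X + h) % q) (Y % q)
      + weight (X % q) ((Y + h) % q) + weight ((X + h) % q) ((Y + h) % q) ≡ 3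
  weights-of-shifts X Y with half-turn X | half-turn Y
  ... | r , r<h , inj₁ (p , p′) | s , s<h , inj₁ (k , k′)
    rewrite p | p′ | k | k′ = three-of-four r s r<h s<h
  ... | r , r<h , inj₂ (p , p′) | s , s<h , inj₁ (k , k′)
    rewrite p | p′ | k | k′ = trans (perm (weight (h + r) s) (weight r s) _ _) (three-of-four r s r<h s<h)
    where
    perm : ∀ a b c d → a + b + c + d ≡ b + a + d + c
    perm = solve-∀
  ... | r , r<h , inj₁ (p , p′) | s , s<h , inj₂ (k , k′)
    rewrite p | p′ | k | k′ = trans (perm (weight r (h + s)) (weight (h + r) (h + s)) _ _) (three-of-four r s r<h s<h)
    where
    perm : ∀ a b c d → a + b + c + d ≡ c + d + a + b
    perm = solve-∀
  ... | r , r<h , inj₂ (p , p′) | s , s<h , inj₂ (k , k′)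
    rewrite p | p′ | k | k′ = trans (perm (weight (h + r) (h + s)) (weight r (h + s)) _ _) (three-of-four r s r<h s<h)
    where
    perm : ∀ a b c d → a + b + c + d ≡ d + c + b + a
    perm = solve-∀

  prepend : ℕ → ℕ → List (ℕ × ℕ) → List (ℕ × ℕ)
  prepend α β = map (λ (a , b) → α + a * q , β + b * q)

  shifts : ℕ → List (ℕ × ℕ)
  shifts zero    = (0 , 0) ∷ []
  shifts (suc d) = prepend 0 0 (shifts d) ++ prepend h 0 (shifts d)
                ++ prepend 0 h (shifts d) ++ prepend h h (shifts d)

  length-prepend : ∀ α β ss → length (prepend α β ss) ≡ length ss
  length-prepend α β = length-map _

  length-shifts : ∀ d → length (shifts d) ≡ 4 ^ d
  length-shifts zero    = refl
  length-shifts (suc d)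
    rewrite length-++ (prepend 0 0 (shifts d)) {prepend h 0 (shifts d) ++ prepend 0 h (shifts d) ++ prepend h h (shifts d)}
          | length-++ (prepend h 0 (shifts d)) {prepend 0 h (shifts d) ++ prepend h h (shifts d)}
          | length-++ (prepend 0 h (shifts d)) {prepend h h (shifts d)}
          | length-prepend 0 0 (shifts d) | length-prepend h 0 (shifts d)
          | length-prepend 0 h (shifts d) | length-prepend h h (shifts d)
          | length-shifts d | +-identityʳ (4 ^ d) = refl

  balances : ℕ → ℕ → ℕ → ℕ × ℕ → Bool
  balances d X Y (a , b) = balanced d (X + a) (Y + b)

  -- The lowest digits α and β determine the lowest test and the carry into the quotients, whatever
  -- the higher digits (a, b) of the shift; hence the count is a product.
  count-prepend : ∀ d X Y α β ss →
    count (balances (suc d) X Y) (prepend α β ss)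
      ≡ weight ((X + α) % q) ((Y + β) % q) * count (balances d ((X + α) / q) ((Y + β) / q)) ss
  count-prepend d X Y α β []             = sym (*-zeroʳ (weight ((X + α) % q) ((Y + β) % q)))
  count-prepend d X Y α β ((a , b) ∷ ss) = begin
    indicator (central ((X + (α + a * q)) % q) ((Y + (β + b * q)) % q)
               ∧ balanced d ((X + (α + a * q)) / q) ((Y + (β + b * q)) / q)) + _
      ≡⟨ cong₂ _+_ (cong indicator (cong₂ _∧_ (cong₂ central (low X α a) (low Y β b))
                                              (cong₂ (balanced d) (high X α a) (high Y β b))))
                   (count-prepend d X Y α β ss) ⟩
    indicator (c ∧ p) + indicator c * rest
      ≡⟨ cong (_+ indicator c * rest) (indicator-∧ c p) ⟩
    indicator c * indicator p + indicator c * rest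
      ≡⟨ *-distribˡ-+ (indicator c) (indicator p) rest ⟨
    indicator c * (indicator p + rest) ∎
    where
    open ≡-Reasoning
    c = central ((X + α) % q) ((Y + β) % q)
    p = balances d ((X + α) / q) ((Y + β) / q) (a , b)
    rest = count (balances d ((X + α) / q) ((Y + β) / q)) ss
    indicator-∧ : ∀ c p → indicator (c ∧ p) ≡ indicator c * indicator p
    indicator-∧ true  p = sym (+-identityʳ (indicator p))
    indicator-∧ false p = refl
    low : ∀ X α a → (X + (α + a * q)) % q ≡ (X + α) % q
    low X α a = trans (cong (_% q) (sym (+-assoc X α (a * q)))) ([m+kn]%n≡m%n (X + α) a q)
    high : ∀ X α a → (X + (α + a * q)) / q ≡ (X + α) / q + a
    high X α a = trans (cong (_/ q) (sym (+-assoc X α (a * q))))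
      (trans (+-distrib-/-∣ʳ (X + α) {d = q} (divides-refl a)) (cong (_+_ ((X + α) / q)) (m*n/n≡m a q)))

  -- The four choices of lowest digits may carry differently, but the induction hypothesis holds for
  -- all X and Y. Each choice contributes its weight times 3^d, and the weights add up to 3.
  count-balances : ∀ d X Y → count (balances d X Y) (shifts d) ≡ 3 ^ d
  count-balances zero    X Y = refl
  count-balances (suc d) X Y = begin
    count b (P 0 0 ++ P h 0 ++ P 0 h ++ P h h)
      ≡⟨ trans (count-++ b (P 0 0) _) (cong (_+_ (count b (P 0 0)))
           (trans (count-++ b (P h 0) _) (cong (_+_ (count b (P h 0))) (count-++ b (P 0 h) _)))) ⟩
    count b (P 0 0) + (count b (P h 0) + (count b (P 0 h) + count b (P h h)))
      ≡⟨ cong₂ _+_ (part 0 0) (cong₂ _+_ (part h 0) (cong₂ _+_ (part 0 h) (part h h))) ⟩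
    w 0 0 * 3 ^ d + (w h 0 * 3 ^ d + (w 0 h * 3 ^ d + w h h * 3 ^ d))
      ≡⟨ factor (w 0 0) (w h 0) (w 0 h) (w h h) (3 ^ d) ⟩
    (w 0 0 + w h 0 + w 0 h + w h h) * 3 ^ d
      ≡⟨ cong (_* 3 ^ d) total ⟩
    3 * 3 ^ d ∎
    where
    open ≡-Reasoning
    b = balances (suc d) X Y
    P : ℕ → ℕ → List (ℕ × ℕ)
    P α β = prepend α β (shifts d)
    w : ℕ → ℕ → ℕ
    w α β = weight ((X + α) % q) ((Y + β) % q)
    part : ∀ α β → count b (P α β) ≡ w α β * 3 ^ d
    part α β = trans (count-prepend d X Y α β (shifts d))
                     (cong (w α β *_) (count-balances d ((X + α) / q) ((Y + β) / q)))
    factor : ∀ a b c d t → a * t + (b * t + (c * t + d * t)) ≡ (a + b + c + d) * t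
    factor = solve-∀
    total : w 0 0 + w h 0 + w 0 h + w h h ≡ 3
    total rewrite +-identityʳ X | +-identityʳ Y = weights-of-shifts X Y

-- Protocols

isOdd : ℕ → Bool
isOdd v = v % 2 ≡ᵇ 1

indicator-isOdd : ∀ v → indicator (isOdd v) ≡ v % 2
indicator-isOdd v with v % 2 | m%n<n v 2
... | 0 | _ = refl
... | 1 | _ = refl
... | suc (suc _) | s≤s (s≤s ())

-- Lowest bit first. Only `f x y` modulo 2^ℓ is transmitted, whence the bounds `f x y < 2 ^ ℓ` in
-- the lemmas on it.
sendZ : ∀ {N} (ℓ : ℕ) → (In N → In N → ℕ) → (ℕ → Protocol N) → Protocol N
sendZ zero    f k = k 0
sendZ (suc ℓ) f k = speakZ (λ x y → isOdd (f x y))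
  λ b → sendZ ℓ (λ x y → f x y / 2) (λ v → k (indicator b + v * 2))

private
  half< : ∀ ℓ {v} → v < 2 ^ suc ℓ → v / 2 < 2 ^ ℓ
  half< ℓ {v} v< = m<n*o⇒m/o<n (subst (v <_) (*-comm 2 (2 ^ ℓ)) v<)

  reassemble : ∀ v → indicator (isOdd v) + v / 2 * 2 ≡ v
  reassemble v = trans (cong (_+ v / 2 * 2) (indicator-isOdd v)) (sym (m≡m%n+[m/n]*n v 2))

-- Keeping the observer `F` abstract lets one induction serve all three output functions.
received : ∀ {N} {C : Set} (F : Protocol N → C) x y →
  (∀ m k → F (speakZ m k) ≡ F (k (m x y))) →
  ∀ ℓ f k → f x y < 2 ^ ℓ → F (sendZ ℓ f k) ≡ F (k (f x y))
received F x y step zero    f k f< = cong (F ∘ k) (sym (n<1⇒n≡0 f<))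
received F x y step (suc ℓ) f k f< =
  trans (step _ _) (trans (received F x y step ℓ _ _ (half< ℓ f<)) (cong (F ∘ k) (reassemble (f x y))))

bits-sendZ : ∀ {N} ℓ f (k : ℕ → Protocol N) x y z → f x y < 2 ^ ℓ →
  bits (sendZ ℓ f k) x y z ≡ ℓ + bits (k (f x y)) x y z
bits-sendZ zero    f k x y z f< = cong (λ v → bits (k v) x y z) (sym (n<1⇒n≡0 f<))
bits-sendZ (suc ℓ) f k x y z f< = cong suc
  (trans (bits-sendZ ℓ _ _ x y z (half< ℓ f<)) (cong (λ v → ℓ + bits (k v) x y z) (reassemble (f x y))))

val : ∀ {N} → In N → ℕ
val x = suc (toℕ x)

module ShiftProtocol
  (N h : ℕ) .{{_ : NonZero h}} (d ℓ₁ ℓ₂ : ℕ) (shift : ℕ → ℕ × ℕ)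
  (choose : ∀ (x y : In N) → ∃ λ i → i < 2 ^ ℓ₁
     × T (Digits.balances h d (val x) (val y) (shift i)))
  (N<qᵈ : N < (2 * h) ^ d) (dist²< : d * sq (2 * h) < 2 ^ ℓ₂)
  where

  open Digits h

  index : In N → In N → ℕ
  index x y = proj₁ (choose x y)

  distance : ℕ → ℕ → ℕ → ℕ
  distance i X Y = dist² d (X + proj₁ (shift i)) (Y + proj₂ (shift i))

  accepts : ℕ → ℕ → ℕ → ℕ → Bool
  accepts i r X Y = balances d X Y (shift i) ∧ (distance i X Y ≡ᵇ r)

  -- The guards exclude truncated subtraction. If one fails, x + y + z exceeds N, so rejecting is
  -- right.
  checkX checkY : ℕ → ℕ → In N → In N → Bool
  checkX i r y z = (val y + val z ≤ᵇ N) ∧ accepts i r (N ∸ (val y + val z)) (val y)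
  checkY i r x z = (val x + val z ≤ᵇ N) ∧ accepts i r (val x) (N ∸ (val x + val z))

  verdict : ℕ → ℕ → Protocol N
  verdict i r = speakX (checkX i r) λ bx → speakY (checkY i r) λ by →
    leaf (λ _ _ → bx ∧ by) (λ _ _ → bx ∧ by) (λ _ _ → bx ∧ by)

  protocol : Protocol N
  protocol = sendZ ℓ₁ index λ i → sendZ ℓ₂ (λ x y → distance i (val x) (val y)) (verdict i)

  distance< : ∀ i X Y → distance i X Y < 2 ^ ℓ₂
  distance< i X Y = ≤-<-trans (dist²-bound d _ _) dist²<

  bits-protocol : ∀ x y z → bits protocol x y z ≡ ℓ₁ + (ℓ₂ + 2)
  bits-protocol x y z = trans (bits-sendZ ℓ₁ _ _ x y z (proj₁ (proj₂ (choose x y))))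
    (cong (_+_ ℓ₁) (bits-sendZ ℓ₂ _ (verdict (index x y)) x y z (distance< (index x y) (val x) (val y))))

  run : ∀ {C : Set} (F : Protocol N → C) x y → (∀ m k → F (speakZ m k) ≡ F (k (m x y))) →
        F protocol ≡ F (verdict (index x y) (distance (index x y) (val x) (val y)))
  run F x y step = trans (received F x y step ℓ₁ _ _ (proj₁ (proj₂ (choose x y))))
    (received F x y step ℓ₂ _ (verdict (index x y)) (distance< (index x y) (val x) (val y)))

  private
    ∧-T : ∀ {b c} → T (b ∧ c) → T b × T c
    ∧-T {b} = Equivalence.to (T-∧ {b})

    T-∧′ : ∀ {b c} → T b → T c → T (b ∧ c)
    T-∧′ {b} s t = Equivalence.from (T-∧ {b}) (s , t)

    accepts⇒ : ∀ i r X Y → T (accepts i r X Y) → T (balances d X Y (shift i)) × distance i X Y ≡ r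
    accepts⇒ i r X Y t with ∧-T {balances d X Y (shift i)} t
    ... | b , e = b , ≡ᵇ⇒≡ _ _ e

  module _ (x y z : In N) where
    private
      i = index x y
      r = distance i (val x) (val y)
      verdictBit = checkX i r y z ∧ checkY i r x z

    -- Acceptance gives (x′, y) and (x, y′) the announced distance of (x, y), and x′ + y = N - z = x
    -- + y′. Then `corner-free` yields x′ = x, which means x + y + z = N.
    sound : T verdictBit → T (exactlyN N x y z)
    sound t with ∧-T {checkX i r y z} t
    ... | tx , ty with ∧-T {val y + val z ≤ᵇ N} tx | ∧-T {val x + val z ≤ᵇ N} ty
    ...   | yz≤N , ax | xz≤N , ay
      with accepts⇒ i r (N ∸ (val y + val z)) (val y) ax | accepts⇒ i r (val x) (N ∸ (val x + val z)) ay
    ...     | bx , rx | by , ry = ≡⇒≡ᵇ _ _ (trans (+-assoc (val x) (val y) (val z))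
                (trans (cong (_+ (val y + val z)) (sym x′≡x)) x′+yz))
      where
      x′ = N ∸ (val y + val z)
      y′ = N ∸ (val x + val z)
      x′+yz : x′ + (val y + val z) ≡ N
      x′+yz = m∸n+n≡m (≤ᵇ⇒≤ (val y + val z) N yz≤N)
      y′+xz : y′ + (val x + val z) ≡ N
      y′+xz = m∸n+n≡m (≤ᵇ⇒≤ (val x + val z) N xz≤N)
      regroup : ∀ a b c → a + (b + c) ≡ b + a + c
      regroup = solve-∀
      sums : x′ + val y ≡ val x + y′
      sums = +-cancelʳ-≡ (val z) _ _ (trans (+-assoc x′ (val y) (val z))
               (trans x′+yz (trans (sym y′+xz) (regroup y′ (val x) (val z)))))
      x′≡x : x′ ≡ val x
      -- `toℕ<n x` is literally `val x ≤ N`, since `val` counts from 1.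
      x′≡x = corner-free d {proj₁ (shift i)} {proj₂ (shift i)} (≤-<-trans (toℕ<n x) N<qᵈ)
               (≤-<-trans (m∸n≤m N (val y + val z)) N<qᵈ) sums bx by rx ry

    -- When x + y + z = N, x′ = x and y′ = y, so both players test the very pair from which P_z
    -- computed the announced index and distance.
    complete : T (exactlyN N x y z) → T verdictBit
    complete t = T-∧′ {checkX i r y z}
      (T-∧′ {val y + val z ≤ᵇ N} (≤⇒≤ᵇ (subst (val y + val z ≤_) yz+x (m≤m+n _ (val x))))
        (subst (λ w → T (accepts i r w (val y))) (sym x′≡x) accepted))
      (T-∧′ {val x + val z ≤ᵇ N} (≤⇒≤ᵇ (subst (val x + val z ≤_) xz+y (m≤m+n _ (val y))))
        (subst (λ w → T (accepts i r (val x) w)) (sym y′≡y) accepted))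
      where
      total : val x + val y + val z ≡ N
      total = ≡ᵇ⇒≡ (val x + val y + val z) N t
      rot₁ : ∀ a b c → b + c + a ≡ a + b + c
      rot₁ = solve-∀
      rot₂ : ∀ a b c → a + c + b ≡ a + b + c
      rot₂ = solve-∀
      yz+x : val y + val z + val x ≡ N
      yz+x = trans (rot₁ (val x) (val y) (val z)) total
      xz+y : val x + val z + val y ≡ N
      xz+y = trans (rot₂ (val x) (val y) (val z)) total
      x′≡x : N ∸ (val y + val z) ≡ val x
      x′≡x = trans (cong (_∸ (val y + val z)) (sym yz+x)) (m+n∸m≡n (val y + val z) (val x))
      y′≡y : N ∸ (val x + val z) ≡ val y
      y′≡y = trans (cong (_∸ (val x + val z)) (sym xz+y)) (m+n∸m≡n (val x + val z) (val y))
      accepted : T (accepts i r (val x) (val y))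
      accepted = T-∧′ {balances d (val x) (val y) (shift i)} (proj₂ (proj₂ (choose x y))) (≡⇒≡ᵇ r r refl)

    verdict≡exactlyN : verdictBit ≡ exactlyN N x y z
    verdict≡exactlyN = ⇔→≡ (mk⇔
      (Equivalence.to T-≡ ∘ sound ∘ Equivalence.from T-≡)
      (Equivalence.to T-≡ ∘ complete ∘ Equivalence.from T-≡))

    correct : (outputX protocol x y z ≡ exactlyN N x y z)
            × (outputY protocol x y z ≡ exactlyN N x y z)
            × (outputZ protocol x y z ≡ exactlyN N x y z)
    correct = trans (run (λ π → outputX π x y z) x y (λ _ _ → refl)) verdict≡exactlyN
            , trans (run (λ π → outputY π x y z) x y (λ _ _ → refl)) verdict≡exactlyN
            , trans (run (λ π → outputZ π x y z) x y (λ _ _ → refl)) verdict≡exactlyN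

-- Choice of parameters

n<2^n : ∀ n → n < 2 ^ n
n<2^n zero    = z<s
n<2^n (suc n) = ≤-trans (+-mono-≤ (m^n>0 2 n) (n<2^n n))
  (≤-reflexive (cong (_+_ (2 ^ n)) (sym (+-identityʳ (2 ^ n)))))

^-distribʳ-* : ∀ m n o → (m * n) ^ o ≡ m ^ o * n ^ o
^-distribʳ-* m n zero    = refl
^-distribʳ-* m n (suc o) = trans (cong (m * n *_) (^-distribʳ-* m n o)) (interchange m n (m ^ o) (n ^ o))
  where
  interchange : ∀ a b c d → a * b * (c * d) ≡ a * c * (b * d)
  interchange = solve-∀

length-cartesianProduct : ∀ {A B : Set} (xs : List A) (ys : List B) →
  length (cartesianProduct xs ys) ≡ length xs * length ys
length-cartesianProduct []       ys = refl
length-cartesianProduct (x ∷ xs) ys = trans (length-++ (map (x ,_) ys))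
  (cong₂ _+_ (length-map (x ,_) ys) (length-cartesianProduct xs ys))

-- 4⁴ = 256 ≤ 324 = 4 · 3⁴.
shifts-dense : ∀ k → 4 ^ (4 * k) ≤ 4 ^ k * 3 ^ (4 * k)
shifts-dense k = begin
  4 ^ (4 * k)         ≡⟨ ^-*-assoc 4 4 k ⟨
  256 ^ k             ≤⟨ ^-monoˡ-≤ k (m≤m+n 256 68) ⟩
  324 ^ k             ≡⟨ ^-distribʳ-* 4 81 k ⟩
  4 ^ k * 81 ^ k      ≡⟨ cong (4 ^ k *_) (^-*-assoc 3 4 k) ⟩
  4 ^ k * 3 ^ (4 * k) ∎
  where open ≤-Reasoning

-- Opaque, lest 2 ^ logRange (suc t) unfold into 2²⁵⁶ copies of a smaller power.
opaque
  logRange : ℕ → ℕ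
  logRange t = 256 * (t * t)

  logRange≡ : ∀ t → logRange t ≡ 256 * (t * t)
  logRange≡ t = refl

  logRange-mono : ∀ {s t} → s ≤ t → logRange s ≤ logRange t
  logRange-mono s≤t = *-monoʳ-≤ 256 (*-mono-≤ s≤t s≤t)

  logRange-suc : ∀ t → logRange t < logRange (suc t)
  logRange-suc t = *-monoʳ-< 256 (*-mono-< (n<1+n t) (n<1+n t))

module AtLevel (N t : ℕ) (N< : N < 2 ^ logRange t) where

  -- Here h = 2^k and k d = 256 t² = `logRange t`, so h^d already exceeds N. `ℓ₁` has room for the
  -- 512 t² 4^k shifts of the codebook, and `ℓ₂` for distances up to d q² = 128 t 4^k. Estimating t
  -- by 2^t raises the leading cost from 32 t to 35 t, which remains affordable.
  k d ℓ₁ ℓ₂ : ℕ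
  k  = 8 * t
  d  = 4 * k
  ℓ₁ = (9 + (t + t)) + 2 * k
  ℓ₂ = (7 + t) + 2 * k

  instance
    2^k≢0 : NonZero (2 ^ k)
    2^k≢0 = m^n≢0 2 k

  open Digits (2 ^ k) using (q; balances; shifts; length-shifts; count-balances)

  inputs : List (In N × In N)
  inputs = cartesianProduct (allFin N) (allFin N)

  length-inputs : length inputs ≡ N * N
  length-inputs = trans (length-cartesianProduct (allFin N) (allFin N))
    (cong₂ _*_ (length-tabulate {n = N} id) (length-tabulate {n = N} id))

  inputs< : length inputs < 2 ^ (logRange t + logRange t)
  inputs< = subst₂ _<_ (sym length-inputs) (sym (^-distribˡ-+-* 2 (logRange t) (logRange t))) (*-mono-< N< N<)

  balancesInput : ℕ × ℕ → In N × In N → Bool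
  balancesInput s (x , y) = balances d (val x) (val y) s

  dense : ∀ u → length (shifts d) ≤ 4 ^ k * count (λ s → balancesInput s u) (shifts d)
  dense (x , y) = subst₂ (λ a b → a ≤ 4 ^ k * b) (sym (length-shifts d))
    (sym (count-balances d (val x) (val y))) (shifts-dense k)

  open GreedyCover balancesInput (shifts d)
    (subst (0 <_) (sym (length-shifts d)) (m^n>0 4 d)) (4 ^ k) (m^n>0 4 k) dense
    using (cover)

  4^k≡ : 4 ^ k ≡ 2 ^ (2 * k)
  4^k≡ = ^-*-assoc 2 2 k

  codebook≤ : (logRange t + logRange t) * 4 ^ k ≤ 2 ^ ℓ₁
  codebook≤ = begin
    (logRange t + logRange t) * 4 ^ k          ≡⟨ cong₂ _*_ (trans (cong₂ _+_ (logRange≡ t) (logRange≡ t)) (regroup t)) 4^k≡ ⟩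
    512 * (t * t) * 2 ^ (2 * k)                ≤⟨ *-monoˡ-≤ (2 ^ (2 * k)) (*-monoʳ-≤ 512 (*-mono-≤ t≤ t≤)) ⟩
    2 ^ 9 * (2 ^ t * 2 ^ t) * 2 ^ (2 * k)      ≡⟨ cong (λ w → 2 ^ 9 * w * 2 ^ (2 * k)) (^-distribˡ-+-* 2 t t) ⟨
    2 ^ 9 * 2 ^ (t + t) * 2 ^ (2 * k)          ≡⟨ cong (_* 2 ^ (2 * k)) (^-distribˡ-+-* 2 9 (t + t)) ⟨
    2 ^ (9 + (t + t)) * 2 ^ (2 * k)            ≡⟨ ^-distribˡ-+-* 2 (9 + (t + t)) (2 * k) ⟨
    2 ^ ℓ₁                                     ∎
    where
    open ≤-Reasoning
    t≤ : t ≤ 2 ^ t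
    t≤ = <⇒≤ (n<2^n t)
    regroup : ∀ t → 256 * (t * t) + 256 * (t * t) ≡ 512 * (t * t)
    regroup = solve-∀

  -- All N² pairs are served by 2 `logRange t` halvings. The input plays no part in the choice, so
  -- the players share the codebook in advance.
  codebook = cover (logRange t + logRange t) inputs inputs<

  shift : ℕ → ℕ × ℕ
  shift = nth (0 , 0) (proj₁ codebook)

  choose : (x y : In N) → ∃ λ i → i < 2 ^ ℓ₁ × T (balances d (val x) (val y) (shift i))
  choose x y with codebook
  ... | cs , len , cov with Any⇒nth (0 , 0) (cov (∈-cartesianProduct⁺ (∈-allFin x) (∈-allFin y)))
  ...   | i , i< , ok = i , <-≤-trans (subst (i <_) len i<) codebook≤ , ok

  N<qᵈ : N < q ^ d
  N<qᵈ = begin-strict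
    N                  <⟨ N< ⟩
    2 ^ logRange t     ≡⟨ cong (2 ^_) (trans (logRange≡ t) (regroup t)) ⟩
    2 ^ (k * d)        ≡⟨ ^-*-assoc 2 k d ⟨
    (2 ^ k) ^ d        ≤⟨ ^-monoˡ-≤ d (m≤m+n (2 ^ k) _) ⟩
    q ^ d              ∎
    where
    open ≤-Reasoning
    regroup : ∀ t → 256 * (t * t) ≡ 8 * t * (4 * (8 * t))
    regroup = solve-∀

  dist²< : d * sq q < 2 ^ ℓ₂
  dist²< = begin-strict
    d * sq q                      ≡⟨ regroup t (2 ^ k) ⟩
    128 * t * (2 ^ k * 2 ^ k)     ≡⟨ cong (128 * t *_) (trans (cong (λ e → 2 ^ (k + e)) (+-identityʳ k)) (^-distribˡ-+-* 2 k k)) ⟨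
    128 * t * 2 ^ (2 * k)         <⟨ *-monoˡ-< (2 ^ (2 * k)) (*-monoʳ-< 128 (n<2^n t)) ⟩
    2 ^ 7 * 2 ^ t * 2 ^ (2 * k)   ≡⟨ cong (_* 2 ^ (2 * k)) (^-distribˡ-+-* 2 7 t) ⟨
    2 ^ (7 + t) * 2 ^ (2 * k)     ≡⟨ ^-distribˡ-+-* 2 (7 + t) (2 * k) ⟨
    2 ^ ℓ₂                        ∎
    where
    open ≤-Reasoning
    instance
      2^2k≢0 : NonZero (2 ^ (2 * k))
      2^2k≢0 = m^n≢0 2 (2 * k)
    regroup : ∀ t h → 4 * (8 * t) * ((2 * h) * (2 * h)) ≡ 128 * t * (h * h)
    regroup = solve-∀

  open ShiftProtocol N (2 ^ k) d ℓ₁ ℓ₂ shift choose N<qᵈ dist²< public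
    using (protocol; correct)
    renaming (bits-protocol to bits-ℓ)

  bits-protocol : ∀ x y z → bits protocol x y z ≡ 35 * t + 18
  bits-protocol x y z = trans (bits-ℓ x y z) (regroup t)
    where
    regroup : ∀ t → 9 + (t + t) + 2 * (8 * t) + (7 + t + 2 * (8 * t) + 2) ≡ 35 * t + 18
    regroup = solve-∀

-- Choice of the level from N

level : ℕ → ℕ
level zero    = zero
level (suc N) with suc N <? 2 ^ logRange (level N)
... | yes _ = level N
... | no  _ = suc (level N)

-- One step up suffices when `suc N` reaches the threshold, because `logRange` increases strictly.
level-upper : ∀ N → N < 2 ^ logRange (level N)
level-upper zero    = m^n>0 2 (logRange 0)
level-upper (suc N) with suc N <? 2 ^ logRange (level N)
... | yes N< = N<
... | no  _  = ≤-<-trans (level-upper N) (^-monoʳ-< 2 (s≤s z<s) (logRange-suc (level N)))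

-- The level rises only when N reaches the old threshold. Hence level s + 1 forces √(log N) ≥ 16 s,
-- against which the cost is measured.
level-lower : ∀ N {s} → level N ≡ suc s → 2 ^ logRange s ≤ N
level-lower (suc N) eq with suc N <? 2 ^ logRange (level N)
... | yes _  = m≤n⇒m≤1+n (level-lower N eq)
... | no  N≮ = subst (λ s → 2 ^ logRange s ≤ suc N) (suc-injective eq) (≮⇒≥ N≮)

level-large : ∀ S N → 2 ^ logRange S ≤ N → ∃ λ s → level N ≡ suc s × S ≤ s
level-large S N N≥ with level N in eq
... | zero  = ⊥-elim (<-irrefl refl (<-≤-trans (subst (λ t → N < 2 ^ logRange t) eq (level-upper N))
                (≤-trans (^-monoʳ-≤ 2 (logRange-mono {0} {S} z≤n)) N≥)))
... | suc s with S ≤? s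
...   | yes S≤s = s , refl , S≤s
...   | no  S≰s = ⊥-elim (<-irrefl refl (<-≤-trans (subst (λ t → N < 2 ^ logRange t) eq (level-upper N))
                    (≤-trans (^-monoʳ-≤ 2 (logRange-mono (≰⇒> S≰s))) N≥)))

opaque
  exactlyN-protocol : (N : ℕ) → Protocol N
  exactlyN-protocol N = AtLevel.protocol N (level N) (level-upper N)

  exactlyN-correct : (N : ℕ) (x y z : In N) →
      (outputX (exactlyN-protocol N) x y z ≡ exactlyN N x y z)
    × (outputY (exactlyN-protocol N) x y z ≡ exactlyN N x y z)
    × (outputZ (exactlyN-protocol N) x y z ≡ exactlyN N x y z)
  exactlyN-correct N = AtLevel.correct N (level N) (level-upper N)

  exactlyN-bits : ∀ N x y z → bits (exactlyN-protocol N) x y z ≡ 35 * level N + 18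
  exactlyN-bits N = AtLevel.bits-protocol N (level N) (level-upper N)

-- For s ≥ 53 the cost 35 (s + 1) + 18 is at most 36 s, while log₂ N ≥ 256 s².
cost-small : ∀ P Q → 16 * Q ≤ 3 * P → ∀ N s → 53 ≤ s → 2 ^ logRange s ≤ N →
  2 ^ (Q * sq (35 * suc s + 18)) ≤ N ^ P
cost-small P Q 16Q≤3P N s 53≤s N≥ = begin
  2 ^ (Q * sq (35 * suc s + 18))  ≤⟨ ^-monoʳ-≤ 2 exponent ⟩
  2 ^ (logRange s * P)            ≡⟨ ^-*-assoc 2 (logRange s) P ⟨
  (2 ^ logRange s) ^ P            ≤⟨ ^-monoˡ-≤ P N≥ ⟩
  N ^ P                           ∎
  where
  open ≤-Reasoning
  regroup₀ : ∀ s → 35 * suc s + 18 ≡ 35 * s + 53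
  regroup₀ = solve-∀
  regroup₁ : ∀ s → 35 * s + s ≡ 36 * s
  regroup₁ = solve-∀
  cost≤ : 35 * suc s + 18 ≤ 36 * s
  cost≤ = subst₂ _≤_ (sym (regroup₀ s)) (regroup₁ s) (+-monoʳ-≤ (35 * s) 53≤s)
  regroup₂ : ∀ Q s → Q * ((36 * s) * (36 * s)) ≡ 81 * (s * s) * (16 * Q)
  regroup₂ = solve-∀
  regroup₃ : ∀ P s → 81 * (s * s) * (3 * P) ≡ 243 * (s * s) * P
  regroup₃ = solve-∀
  -- 36² = 81 · 16 lets 16 Q ≤ 3 P apply, and 81 · 3 = 243 fits under 256.
  exponent : Q * sq (35 * suc s + 18) ≤ logRange s * P
  exponent = begin
    Q * sq (35 * suc s + 18)      ≤⟨ *-monoʳ-≤ Q (*-mono-≤ cost≤ cost≤) ⟩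
    Q * sq (36 * s)               ≡⟨ regroup₂ Q s ⟩
    81 * (s * s) * (16 * Q)       ≤⟨ *-monoʳ-≤ (81 * (s * s)) 16Q≤3P ⟩
    81 * (s * s) * (3 * P)        ≡⟨ regroup₃ P s ⟩
    243 * (s * s) * P             ≤⟨ *-monoˡ-≤ P (*-monoˡ-≤ (s * s) (m≤m+n 243 13)) ⟩
    256 * (s * s) * P             ≡⟨ cong (_* P) (logRange≡ s) ⟨
    logRange s * P                ∎

-- From one fixed threshold on, the cost is at most (9/4) √(log N), so the threshold can be
-- independent of `P` and `Q`.
bits-small : ∀ P Q → 16 * Q ≤ 3 * P → ∀ N → 2 ^ logRange 53 ≤ N → ∀ x y z →
  2 ^ (Q * sq (bits (exactlyN-protocol N) x y z)) ≤ N ^ P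
bits-small P Q 16Q≤3P N N≥ x y z =
  subst (λ b → 2 ^ (Q * sq b) ≤ N ^ P) (sym cost) (cost-small P Q 16Q≤3P N s 53≤s (level-lower N eq))
  where
  s = proj₁ (level-large 53 N N≥)
  eq : level N ≡ suc s
  eq = proj₁ (proj₂ (level-large 53 N N≥))
  53≤s : 53 ≤ s
  53≤s = proj₂ (proj₂ (level-large 53 N N≥))
  cost : bits (exactlyN-protocol N) x y z ≡ 35 * suc s + 18
  cost = trans (exactlyN-bits N x y z) (cong (λ t → 35 * t + 18) eq)

-- Partial sums of ln 2

toℚᵘ-/ : ∀ i n .{{_ : NonZero n}} → toℚᵘ (i ℚ./ n) ℚᵘ.≃ i ℚᵘ./ n
toℚᵘ-/ i (suc n) = ℚ.toℚᵘ-fromℚᵘ (mkℚᵘ i n)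

unit-fractions-≤ : ∀ u v b .{{_ : NonZero u}} .{{_ : NonZero v}} .{{_ : NonZero b}} →
  (v + u) * b ≤ u * v → (+ 1 ℚᵘ./ u) ℚᵘ.+ (+ 1 ℚᵘ./ v) ℚᵘ.≤ + 1 ℚᵘ./ b
unit-fractions-≤ (suc u) (suc v) (suc b) le =
  *≤* (subst₂ ℤ._≤_ lhs rhs (+≤+ le))
  where
  lhs : + ((suc v + suc u) * suc b) ≡ (+ 1 ℤ.* + suc v ℤ.+ + 1 ℤ.* + suc u) ℤ.* + suc b
  lhs = trans (ℤ.pos-* (suc v + suc u) (suc b)) (cong (ℤ._* + suc b)
    (sym (cong₂ ℤ._+_ (ℤ.*-identityˡ (+ suc v)) (ℤ.*-identityˡ (+ suc u)))))
  rhs : + (suc u * suc v) ≡ + 1 ℤ.* + (suc u * suc v)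
  rhs = sym (ℤ.*-identityˡ (+ (suc u * suc v)))

2^-_ : ℕ → ℚᵘ.ℚᵘ
2^- n = (+ 1 ℚᵘ./ 2 ^ n) {{m^n≢0 2 n}}

-- Σ_{k > K} 1/(k 2ᵏ) ≤ 2^-(K+1) for K ≥ 1; adding this bound makes the induction go through.
lnTwoPartial-tail : ∀ K → toℚᵘ (lnTwoPartial (suc K)) ℚᵘ.+ 2^- (2 + K) ℚᵘ.≤ + 3 ℚᵘ./ 4
-- Equality 1/2 + 1/4 = 3/4: the source of the constant 3/4.
lnTwoPartial-tail zero    = *≤* (+≤+ (m≤m+n _ _))
lnTwoPartial-tail (suc K) = begin
  toℚᵘ (S ℚ.+ (+ 1 ℚ./ u)) ℚᵘ.+ w₃           ≃⟨ ℚᵘ.+-congˡ w₃ (ℚ.toℚᵘ-homo-+ S (+ 1 ℚ./ u)) ⟩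
  toℚᵘ S ℚᵘ.+ toℚᵘ (+ 1 ℚ./ u) ℚᵘ.+ w₃       ≃⟨ ℚᵘ.+-congˡ w₃ (ℚᵘ.+-congʳ (toℚᵘ S) (toℚᵘ-/ (+ 1) u)) ⟩
  toℚᵘ S ℚᵘ.+ (+ 1 ℚᵘ./ u) ℚᵘ.+ w₃           ≃⟨ ℚᵘ.+-assoc (toℚᵘ S) (+ 1 ℚᵘ./ u) w₃ ⟩
  toℚᵘ S ℚᵘ.+ ((+ 1 ℚᵘ./ u) ℚᵘ.+ w₃)         ≤⟨ ℚᵘ.+-monoʳ-≤ (toℚᵘ S) (unit-fractions-≤ u (2 * b) b arith) ⟩
  toℚᵘ S ℚᵘ.+ (+ 1 ℚᵘ./ b)                   ≤⟨ lnTwoPartial-tail K ⟩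
  + 3 ℚᵘ./ 4                                 ∎
  where
  open ℚᵘ.≤-Reasoning
  S = lnTwoPartial (suc K)
  b = 2 ^ (2 + K)
  u = (2 + K) * b
  instance
    b≢0 : NonZero b
    b≢0 = m^n≢0 2 (2 + K)
    2b≢0 : NonZero (2 * b)
    2b≢0 = m^n≢0 2 (3 + K)
    u≢0 : NonZero u
    u≢0 = m*n≢0 (2 + K) b
  w₃ = 2^- (3 + K)
  identity : ∀ K b → (2 + K) * b * (2 * b) ≡ (2 * b + (2 + K) * b) * b + K * (b * b)
  identity = solve-∀
  -- As K + 2 ≥ 2, the new term 1/((K + 2) b) uses at most half of the slack 1/b.
  arith : (2 * b + u) * b ≤ u * (2 * b)
  arith = ≤-trans (m≤m+n _ (K * (b * b))) (≤-reflexive (sym (identity K b)))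

lnTwoPartial≤¾ : ∀ K → toℚᵘ (lnTwoPartial K) ℚᵘ.≤ + 3 ℚᵘ./ 4
lnTwoPartial≤¾ zero    = *≤* (+≤+ z≤n)
lnTwoPartial≤¾ (suc K) = ℚᵘ.≤-trans
    (ℚᵘ.p≤p+q (toℚᵘ (lnTwoPartial (suc K))) (2^- (2 + K)) {{nonNeg (2 ^ (2 + K)) {{m^n≢0 2 (2 + K)}}}})
    (lnTwoPartial-tail K)
  where
  nonNeg : ∀ n .{{_ : NonZero n}} → ℚᵘ.NonNegative (+ 1 ℚᵘ./ n)
  nonNeg (suc n) = _

-- In use, √(P/Q) is a rational above 2 √(log e): partial sums stay below ln 2 = 1/log e, so `K`
-- certifies P/Q > 4 log e. Bounding the partial sum by 3/4 weakens this to P/Q > 16/3.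
ratio-bound : ∀ K Q P → (+ (4 * Q) ℚ./ 1) ℚ.< lnTwoPartial K *ℚ (+ P ℚ./ 1) → 16 * Q ≤ 3 * P
ratio-bound K Q P lt = <⇒≤ (ℤ.drop‿+<+ (subst₂ ℤ._<_ lhs rhs (ℚᵘ.drop-*<* chain)))
  where
  open ℚᵘ.≤-Reasoning
  chain : mkℚᵘ (+ (4 * Q)) 0 ℚᵘ.< mkℚᵘ (+ 3) 3 ℚᵘ.* mkℚᵘ (+ P) 0
  chain = begin-strict
    mkℚᵘ (+ (4 * Q)) 0                        ≃⟨ toℚᵘ-/ (+ (4 * Q)) 1 ⟨
    toℚᵘ (+ (4 * Q) ℚ./ 1)                    <⟨ ℚ.toℚᵘ-mono-< lt ⟩
    toℚᵘ (lnTwoPartial K *ℚ (+ P ℚ./ 1))      ≃⟨ ℚ.toℚᵘ-homo-* (lnTwoPartial K) (+ P ℚ./ 1) ⟩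
    toℚᵘ (lnTwoPartial K) ℚᵘ.* toℚᵘ (+ P ℚ./ 1) ≃⟨ ℚᵘ.*-congˡ {toℚᵘ (lnTwoPartial K)} (toℚᵘ-/ (+ P) 1) ⟩
    toℚᵘ (lnTwoPartial K) ℚᵘ.* mkℚᵘ (+ P) 0   ≤⟨ ℚᵘ.*-monoˡ-≤-nonNeg (mkℚᵘ (+ P) 0) (lnTwoPartial≤¾ K) ⟩
    mkℚᵘ (+ 3) 3 ℚᵘ.* mkℚᵘ (+ P) 0            ∎
  sixteen : ∀ Q → 4 * Q * 4 ≡ 16 * Q
  sixteen = solve-∀
  lhs : + (4 * Q) ℤ.* + 4 ≡ + (16 * Q)
  lhs = trans (sym (ℤ.pos-* (4 * Q) 4)) (cong +_ (sixteen Q))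
  rhs : + 3 ℤ.* + P ℤ.* + 1 ≡ + (3 * P)
  rhs = trans (ℤ.*-identityʳ (+ 3 ℤ.* + P)) (sym (ℤ.pos-* 3 P))

-- The o(√(log N)) term is expressed through rationals: for each p/(q + 1) > 2 √(log e), eventually
-- the cost is at most p/(q + 1) · √(log N). Squaring and exponentiating states this within ℕ.
theorem1p3 : Σ ((N : ℕ) → Protocol N) λ π →
    ((N : ℕ) (x y z : In N) →
    (outputX (π N) x y z ≡ exactlyN N x y z)
    × (outputY (π N) x y z ≡ exactlyN N x y z)
    × (outputZ (π N) x y z ≡ exactlyN N x y z))
    × ((p q : ℕ) →
    (∃ λ K → (+ (4 * (suc q * suc q)) ℚ./ 1) ℚ.< lnTwoPartial K *ℚ (+ (p * p) ℚ./ 1)) →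
    ∃ λ N₀ → (N : ℕ) → N₀ ≤ N → (x y z : In N) →
    2 ^ (suc q * suc q * (bits (π N) x y z * bits (π N) x y z)) ≤ N ^ (p * p))
theorem1p3 = exactlyN-protocol
  , exactlyN-correct
  , λ p q (K , c>) → 2 ^ logRange 53 ,
      bits-small (p * p) (suc q * suc q) (ratio-bound K (suc q * suc q) (p * p) c>)
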